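{- Let $G$ be a graph with at least one edge such that the subgraph of $G$ induced by all vertices of degree at least $3$ is a forest. Then $\chi_s'(G) \le 4\Delta(G) - 3$.
   Context: All graphs are finite and simple; $\Delta(G)$ is the maximum degree. A strong edge coloring of $G$ is an assignment of colors to the edges of $G$ such that every path with three edges receives three distinct colors; equivalently, any two distinct edges that share an endpoint, or whose endpoints are joined by an edge, receive different colors. The strong chromatic index $\chi_s'(G)$ is the minimum number of colors in a strong edge coloring of $G$. -}

module Defs where

open import Data.Bool using (Bool; false; T)
open import Data.Bool.Properties using (T?; T-irrelevant)
open import Data.Fin using (Fin; _<_; funToFin; finToFun)
open import Data.Fin.Properties using (_≟_; _<?_; <-irrelevant; any?; finToFun-funToFin)
open import Data.List using (List; []; _∷_; [_]; _++_; length; map; filter; concatMap; allFin; lookup)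
open import Data.List.Extrema.Nat using (max)
open import Data.List.Membership.Propositional using (_∈_)
open import Data.List.Membership.Propositional.Properties using (∈-allFin; ∈-concatMap⁺)
open import Data.List.Relation.Unary.All using (all?) renaming (lookup to All-lookup; tabulate to All-tabulate)
open import Data.List.Relation.Unary.Any using (here; index) renaming (map to Any-map)
open import Data.List.Relation.Unary.Any.Properties using (lookup-index)
open import Data.List.Relation.Unary.Linked using (Linked)
open import Data.List.Relation.Unary.Unique.Propositional using (Unique)
open import Data.Nat using (ℕ; zero; suc; _≤_; _^_; z≤n; s≤s)
open import Data.Product using (∃; ∃₂; _×_; _,_; proj₁; proj₂)
open import Data.Sum using (_⊎_)
open import Function using (_∘_)
open import Level using (0ℓ)
open import Relation.Binary using (Rel; DecidableEquality)
open import Relation.Binary.PropositionalEquality using (_≡_; _≢_; refl; sym; trans; cong)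
open import Relation.Nullary using (¬_; Dec; yes; no; contradiction)
open import Relation.Nullary.Decidable using (map′; _×-dec_; _⊎-dec_; _→-dec_; ¬?)
open import Relation.Unary using (Pred; Decidable)

record SimpleGraph (V : Set) : Set where
  field
    adj        : V → V → Bool
    adj-sym    : ∀ u v → adj u v ≡ adj v u
    adj-irrefl : ∀ v → adj v v ≡ false

  Adj : Rel V 0ℓ
  Adj u v = T (adj u v)

open SimpleGraph public using (Adj)

Graph : ℕ → Set
Graph n = SimpleGraph (Fin n)

-- When P is proof-irrelevant, as it is below, ∃ P is the subset {v | P v}.
induced : ∀ {V} → SimpleGraph V → (P : Pred V 0ℓ) → SimpleGraph (∃ P)
induced G P = record
  { adj        = λ u v → adj (proj₁ u) (proj₁ v)
  ; adj-sym    = λ u v → adj-sym (proj₁ u) (proj₁ v)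
  ; adj-irrefl = λ v → adj-irrefl (proj₁ v)
  }
  where open SimpleGraph G

-- The cycle v, vs₁, …, vsₖ, v: at least three vertices, all distinct.
IsCycle : ∀ {V} → SimpleGraph V → V → List V → Set
IsCycle G v vs =
  2 ≤ length vs × Unique (v ∷ vs) × Linked (Adj G) (v ∷ vs ++ [ v ])

IsForest : ∀ {V} → SimpleGraph V → Set
IsForest G = ∀ v vs → ¬ IsCycle G v vs

module _ {n : ℕ} (G : Graph n) where
  open SimpleGraph G using (adj)

  degree : Fin n → ℕ
  degree v = length (filter (λ u → T? (adj v u)) (allFin n))

  Δ : ℕ
  Δ = max 0 (map degree (allFin n))

  -- An unordered pair of adjacent vertices, listed in increasing order so
  -- that every edge is represented exactly once.
  record Edge : Set where
    constructor edge
    field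
      src dst  : Fin n
      src<dst  : src < dst
      adjacent : Adj G src dst

  open Edge

  _endpointOf_ : Fin n → Edge → Set
  v endpointOf e = v ≡ src e ⊎ v ≡ dst e

  ShareEndpoint : Rel Edge 0ℓ
  ShareEndpoint e f = ∃ λ v → v endpointOf e × v endpointOf f

  JoinedByEdge : Rel Edge 0ℓ
  JoinedByEdge e f = ∃₂ λ u v → u endpointOf e × v endpointOf f × Adj G u v

  IsStrongEdgeColoring : ∀ {k} → (Edge → Fin k) → Set
  IsStrongEdgeColoring c =
    ∀ e f → e ≢ f → ShareEndpoint e f ⊎ JoinedByEdge e f → c e ≢ c f

  StronglyEdgeColorable : ℕ → Set
  StronglyEdgeColorable k = ∃ λ (c : Edge → Fin k) → IsStrongEdgeColoring c

IsMinimum : Pred ℕ 0ℓ → ℕ → Set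
IsMinimum P k = P k × (∀ j → P j → k ≤ j)

minimum : ∀ {P : Pred ℕ 0ℓ} → Decidable P → ∀ m → P m → ∃ (IsMinimum P)
minimum P? m pm with P? 0
minimum P? m       pm | yes p0 = 0 , p0 , λ _ _ → z≤n
minimum P? zero    pm | no ¬p0 = contradiction pm ¬p0
minimum P? (suc m) pm | no ¬p0 with minimum (P? ∘ suc) m pm
... | k , pk , k≤ = suc k , pk , λ where
  zero    p0 → contradiction p0 ¬p0
  (suc j) pj → s≤s (k≤ j pj)

-- Strong edge-colourability with k colours is decidable and holds for
-- k = |E(G)|, so the minimum defining χ′ₛ exists.
module _ {n : ℕ} (G : Graph n) where
  open SimpleGraph G using (adj)

  edge-≡ : ∀ {e f : Edge G} → Edge.src e ≡ Edge.src f → Edge.dst e ≡ Edge.dst f → e ≡ f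
  edge-≡ {edge s d p a} {edge _ _ q b} refl refl
    rewrite <-irrelevant p q | T-irrelevant a b = refl

  _≟ᴱ_ : DecidableEquality (Edge G)
  e ≟ᴱ f = map′ (λ (p , q) → edge-≡ p q) (λ { refl → refl , refl })
    ((Edge.src e ≟ Edge.src f) ×-dec (Edge.dst e ≟ Edge.dst f))

  edgesBetween : Fin n → Fin n → List (Edge G)
  edgesBetween u v with u <? v | T? (adj u v)
  ... | yes p | yes a = [ edge u v p a ]
  ... | _     | _     = []

  edges : List (Edge G)
  edges = concatMap (λ u → concatMap (edgesBetween u) (allFin n)) (allFin n)

  ∈-edgesBetween : ∀ e → e ∈ edgesBetween (Edge.src e) (Edge.dst e)
  ∈-edgesBetween (edge u v p a) with u <? v | T? (adj u v)
  ... | yes _ | yes _ = here (edge-≡ refl refl)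
  ... | yes _ | no ¬a = contradiction a ¬a
  ... | no ¬p | _     = contradiction p ¬p

  ∈-edges : ∀ e → e ∈ edges
  ∈-edges e =
    ∈-concatMap⁺ _ (Any-map (λ { refl →
      ∈-concatMap⁺ _ (Any-map (λ { refl → ∈-edgesBetween e }) (∈-allFin (Edge.dst e))) })
      (∈-allFin (Edge.src e)))

  indexᴱ : Edge G → Fin (length edges)
  indexᴱ e = index (∈-edges e)

  lookup-indexᴱ : ∀ e → lookup edges (indexᴱ e) ≡ e
  lookup-indexᴱ e = sym (lookup-index (∈-edges e))

  isStrongEdgeColoring? : ∀ {k} (c : Edge G → Fin k) → Dec (IsStrongEdgeColoring G c)
  isStrongEdgeColoring? c =
    map′ (λ h e f → All-lookup (All-lookup h (∈-edges e)) (∈-edges f))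
         (λ h → All-tabulate (λ {e} _ → All-tabulate (λ {f} _ → h e f)))
         (all? (λ e → all? (λ f → ¬? (e ≟ᴱ f) →-dec (close? e f →-dec ¬? (c e ≟ c f))) edges) edges)
    where
    endpoint? : ∀ v e → Dec (_endpointOf_ G v e)
    endpoint? v e = (v ≟ Edge.src e) ⊎-dec (v ≟ Edge.dst e)

    close? : ∀ e f → Dec (ShareEndpoint G e f ⊎ JoinedByEdge G e f)
    close? e f =
      any? (λ v → endpoint? v e ×-dec endpoint? v f) ⊎-dec
      any? (λ u → any? (λ v → endpoint? u e ×-dec (endpoint? v f ×-dec T? (adj u v))))

  stronglyEdgeColorable? : Decidable (StronglyEdgeColorable G)
  stronglyEdgeColorable? k =
    map′ (λ (i , h) → coloring i , h)
         (λ (c , h) → funToFin (c ∘ lookup edges) , λ e f e≢f close eq →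
            h e f e≢f close (trans (sym (agrees c e)) (trans eq (agrees c f))))
         (any? (λ i → isStrongEdgeColoring? (coloring i)))
    where
    coloring : Fin (k ^ length edges) → Edge G → Fin k
    coloring i = finToFun i ∘ indexᴱ

    agrees : ∀ c e → coloring (funToFin (c ∘ lookup edges)) e ≡ c e
    agrees c e = trans (finToFun-funToFin (c ∘ lookup edges) (indexᴱ e)) (cong c (lookup-indexᴱ e))

  stronglyEdgeColorable-∣E∣ : StronglyEdgeColorable G (length edges)
  stronglyEdgeColorable-∣E∣ = indexᴱ , λ e f e≢f _ eq →
    e≢f (trans (sym (lookup-indexᴱ e)) (trans (cong (lookup edges) eq) (lookup-indexᴱ f)))

  minimumColors : ∃ (IsMinimum (StronglyEdgeColorable G))
  minimumColors = minimum stronglyEdgeColorable? (length edges) stronglyEdgeColorable-∣E∣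

  χ′ₛ : ℕ
  χ′ₛ = proj₁ minimumColors

  χ′ₛ-isMinimum : IsMinimum (StronglyEdgeColorable G) χ′ₛ
  χ′ₛ-isMinimum = proj₂ minimumColors

{-# OPTIONS --safe #-}

-- The edges are coloured greedily in increasing order of a rank. Peeling leaves off the
-- forest of heavy vertices (degree at least 3) ranks them so that each has at most one
-- lower-ranked neighbour, its parent; light vertices are ranked above all heavy ones,
-- and an edge gets the smaller rank of its ends. Put Δ = m + 1 and let vu be an edge of
-- rank r(v), v heavy. No edge of rank at most r(v) leaves a heavy vertex x of larger
-- rank, except towards the parent of x. Hence on the side of v at most m edges contain v,
-- at most m contain the parent of v, and at most one contains each of the other (at most
-- m - 1) neighbours; on the side of u there are at most m + 1 edges. An edge between two
-- light vertices has at most 2m neighbours on each side. So at most 4m = 4Δ - 4 colours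
-- are forbidden at every step.

module Submission where

open import Defs
open import Data.Bool using (T)
open import Data.Bool.Properties using (T?)
open import Data.Fin using (Fin)
open import Data.Fin.Properties using (_≟_; <-cmp; any?)
open import Data.List using (List; []; _∷_; [_]; _++_; length; map; filter; concatMap; allFin)
open import Data.List.Extrema.Nat using (xs≤max)
open import Data.List.Membership.Propositional using (_∈_; _∉_; lose; find)
open import Data.List.Membership.Propositional.Properties using (∈-allFin; ∈-concatMap⁺; ∈-filter⁺; ∈-filter⁻; ∈-∃++; ∈-map⁺; ∈-++⁺ˡ; ∈-++⁺ʳ)
open import Data.List.Properties using (length-++; length-map; length-tabulate; length-filter; filter-notAll; filter-none)
open import Data.List.Relation.Binary.Permutation.Propositional using (↭-sym)
open import Data.List.Relation.Binary.Permutation.Propositional.Properties using (∈-resp-↭)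
open import Data.List.Relation.Binary.Subset.Propositional using (_⊆_)
open import Data.List.Relation.Unary.All as All using (All; []; _∷_)
open import Data.List.Relation.Unary.All.Properties using (++⁻ˡ; map⁻)
open import Data.List.Relation.Unary.AllPairs using (AllPairs; []; _∷_)
open import Data.List.Relation.Unary.Any using (here; there) renaming (any? to Any?)
open import Data.List.Relation.Unary.Linked using (Linked; []; [-]; _∷_)
open import Data.List.Relation.Unary.Linked.Properties using (Linked⇒AllPairs)
open import Data.List.Relation.Unary.Unique.Propositional using (Unique)
open import Data.List.Relation.Unary.Unique.Propositional.Properties using (allFin⁺) renaming (filter⁺ to Unique-filter⁺)
open import Data.Nat using (ℕ; zero; suc; _+_; _*_; _∸_; _⊓_; _≤_; _<_; _≤?_; pred; >-nonZero; z≤n; s≤s)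
open import Data.Nat.Properties hiding (_≟_) renaming (<-cmp to ℕ-<-cmp)
open import Data.Nat.Solver using (module +-*-Solver)
open import Data.Product using (∃; _×_; _,_; proj₁; proj₂)
open import Data.Product.Properties using () renaming (≡-dec to ×-≡-dec)
open import Data.Sum using (_⊎_; inj₁; inj₂)
open import Function using (_∘_; flip)
open import Level using (0ℓ)
open import Relation.Binary using (DecidableEquality; Rel; Symmetric; tri<; tri≈; tri>)
import Relation.Binary.Construct.Flip.EqAndOrd as Flip
import Relation.Binary.Construct.On as On
open import Relation.Binary.PropositionalEquality using (_≡_; _≢_; refl; sym; trans; cong; subst; ≢-sym)
open import Relation.Nullary using (¬_; Dec; yes; no; contradiction)
open import Relation.Nullary.Decidable using (_×-dec_; ¬?; decidable-stable)

-- Deletion from lists and the pigeonhole principle.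

module _ {A : Set} (_≟ᴬ_ : DecidableEquality A) where

  _∖_ : List A → A → List A
  xs ∖ x = filter (λ y → ¬? (y ≟ᴬ x)) xs

  ∈-∖⁺ : ∀ {x y xs} → y ∈ xs → y ≢ x → y ∈ xs ∖ x
  ∈-∖⁺ = ∈-filter⁺ _

  ∈-∖⁻ : ∀ {x y} xs → y ∈ xs ∖ x → y ∈ xs × y ≢ x
  ∈-∖⁻ xs = ∈-filter⁻ _ {xs = xs}

  length-∖ : ∀ {x xs} → x ∈ xs → length (xs ∖ x) < length xs
  length-∖ {x} {xs} x∈xs = filter-notAll _ xs (lose x∈xs (λ x≢x → x≢x refl))

  unique-⊆⇒length≤ : ∀ {xs ys} → Unique xs → xs ⊆ ys → length xs ≤ length ys
  unique-⊆⇒length≤ []            _     = z≤n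
  unique-⊆⇒length≤ (x∉xs ∷ uniq) xs⊆ys =
    ≤-trans (s≤s (unique-⊆⇒length≤ uniq λ y∈xs →
              ∈-∖⁺ (xs⊆ys (there y∈xs)) (≢-sym (All.lookup x∉xs y∈xs))))
            (length-∖ (xs⊆ys (here refl)))

-- Otherwise `allFin k`, which has no repetitions, would be contained in the shorter list `xs`.
∃-fresh : ∀ {k} (xs : List (Fin k)) → length xs < k → ∃ (_∉ xs)
∃-fresh {k} xs short with any? (λ i → ¬? (Any? (i ≟_) xs))
... | yes fresh = fresh
... | no ¬fresh = contradiction
  (≤-trans (≤-reflexive (sym (length-tabulate (λ i → i)))) (unique-⊆⇒length≤ _≟_ (allFin⁺ k) covers)) (<⇒≱ short)
  where
  covers : allFin k ⊆ xs
  covers {i} _ = decidable-stable (Any? (i ≟_) xs) (λ i∉ → ¬fresh (i , i∉))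

-- Greedy colouring

module _ {A : Set} (_≟ᴬ_ : DecidableEquality A) (rank : A → ℕ)
         (Conflict : Rel A 0ℓ) (Conflict-sym : Symmetric Conflict)
         {k : ℕ} (earlier : A → List A) (short : ∀ a → length (earlier a) ≤ k)
         (complete : ∀ {a b} → b ≢ a → Conflict a b → rank b ≤ rank a → b ∈ earlier a)
         where

  private
    ProperOn : (A → Fin (suc k)) → List A → Set
    ProperOn c xs = ∀ {a b} → a ∈ xs → b ∈ xs → a ≢ b → Conflict a b → c a ≢ c b

  -- The head has the largest rank and is coloured last: its conflicts in the tail all lie in
  -- `earlier x`, whose at most `k` colours leave one of `suc k` free.
  greedyOn : ∀ {xs} → AllPairs (λ a b → rank b ≤ rank a) xs → ∃ λ c → ProperOn c xs
  -- Colourings are total, so elements outside the list carry a default colour.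
  greedyOn []                        = (λ _ → Fin.zero) , λ ()
  greedyOn {x ∷ xs} (x-last ∷ sorted) with greedyOn sorted
  ... | c , proper = c′ , proper′
    where
    fresh : ∃ (_∉ map c (earlier x))
    fresh = ∃-fresh _ (s≤s (≤-trans (≤-reflexive (length-map c (earlier x))) (short x)))

    c′ : A → Fin (suc k)
    c′ a with a ≟ᴬ x
    ... | yes _ = proj₁ fresh
    ... | no  _ = c a

    avoids : ∀ {a} → a ∈ x ∷ xs → a ≢ x → Conflict x a → proj₁ fresh ≢ c a
    avoids (here a≡x)   a≢x _   _  = a≢x a≡x
    avoids (there a∈xs) a≢x x~a eq = proj₂ fresh
      (subst (_∈ _) (sym eq) (∈-map⁺ c (complete a≢x x~a (All.lookup x-last a∈xs))))

    old : ∀ {a} → a ∈ x ∷ xs → a ≢ x → a ∈ xs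
    old (here a≡x)   a≢x = contradiction a≡x a≢x
    old (there a∈xs) _   = a∈xs

    proper′ : ProperOn c′ (x ∷ xs)
    proper′ {a} {b} a∈ b∈ a≢b a~b with a ≟ᴬ x | b ≟ᴬ x
    ... | yes refl | yes refl = contradiction refl a≢b
    ... | yes refl | no  b≢x  = avoids b∈ b≢x a~b
    ... | no  a≢x  | yes refl = ≢-sym (avoids a∈ a≢x (Conflict-sym a~b))
    ... | no  a≢x  | no  b≢x  = proper (old a∈ a≢x) (old b∈ b≢x) a≢b a~b

  -- The order is flipped because `greedyOn` expects decreasing ranks.
  open import Data.List.Sort (Flip.decTotalOrder (On.decTotalOrder ≤-decTotalOrder rank)) using (sort; sort-↗; sort-↭)

  greedy : (xs : List A) → (∀ a → a ∈ xs) →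
           ∃ λ (c : A → Fin (suc k)) → ∀ a b → a ≢ b → Conflict a b → c a ≢ c b
  greedy xs all∈ with greedyOn (Linked⇒AllPairs (flip ≤-trans) (sort-↗ xs))
  ... | c , proper = c , λ a b → proper (sorted∈ a) (sorted∈ b)
    where
    sorted∈ : ∀ a → a ∈ sort xs
    sorted∈ a = ∈-resp-↭ (↭-sym (sort-↭ xs)) (all∈ a)

-- Forests

module _ {V : Set} (H : SimpleGraph V) where
  open SimpleGraph H using (adj; adj-sym; adj-irrefl)

  Adj-sym : Symmetric (Adj H)
  Adj-sym {u} {v} = subst T (adj-sym u v)

  Adj⇒≢ : ∀ {u v} → Adj H u v → u ≢ v
  Adj⇒≢ {u} u~u refl = subst T (adj-irrefl u) u~u

-- Prepares the cycle closed by a chord: it is based at the far end `y` of the chord, and the path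
-- beyond `y` is dropped.
unique-rotate : ∀ {A : Set} {y : A} xs {zs} → Unique (xs ++ y ∷ zs) → Unique (y ∷ xs)
unique-rotate []       _               = [] ∷ []
unique-rotate (x ∷ xs) (x∉ ∷ uniq) with unique-rotate xs uniq
... | y∉ ∷ uniq′ = (≢-sym (All.lookup x∉ (∈-++⁺ʳ xs (here refl))) ∷ y∉) ∷ ++⁻ˡ xs x∉ ∷ uniq′

linked-prefix : ∀ {A : Set} {R : Rel A 0ℓ} {y} xs {zs} → Linked R (xs ++ y ∷ zs) → Linked R (xs ++ [ y ])
linked-prefix []            _         = [-]
linked-prefix (_ ∷ [])      (r ∷ _)   = r ∷ [-]
linked-prefix (_ ∷ x ∷ xs)  (r ∷ rs)  = r ∷ linked-prefix (x ∷ xs) rs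

module _ {V : Set} (_≟ⱽ_ : DecidableEquality V) (H : SimpleGraph V) (forest : IsForest H) where
  open SimpleGraph H using (adj)

  LeafIn : List V → V → Set
  LeafIn xs x = ∀ {y z} → y ∈ xs → z ∈ xs → Adj H x y → Adj H x z → y ≡ z

  -- The path from `x` to `y` and the edge back would form a cycle; since `y` comes after `p`, it
  -- has at least three vertices.
  no-chord : ∀ {x p y rest} → Unique (x ∷ p ∷ rest) → Linked (Adj H) (x ∷ p ∷ rest) →
             Adj H x y → y ∉ rest
  no-chord {x} {p} {y} uniq linked x~y y∈rest with ∈-∃++ y∈rest
  ... | as , _ , refl = forest y (x ∷ p ∷ as)
    (s≤s (s≤s z≤n) , unique-rotate (x ∷ p ∷ as) uniq , Adj-sym H x~y ∷ linked-prefix (x ∷ p ∷ as) linked)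

  module _ (xs : List V) where

    -- A path that cannot be prolonged at its head ends there in a leaf, since chords close cycles.
    extend : ∀ fuel {x p rest} → Unique (x ∷ p ∷ rest) → Linked (Adj H) (x ∷ p ∷ rest) →
             (x ∷ p ∷ rest) ⊆ xs → length xs < length (x ∷ p ∷ rest) + fuel →
             ∃ λ v → v ∈ xs × LeafIn xs v
    -- With no fuel left, a path without repetitions would be longer than the list containing it.
    extend zero uniq _ path⊆ bound =
      contradiction (unique-⊆⇒length≤ _≟ⱽ_ uniq path⊆) (<⇒≱ (≤-trans bound (≤-reflexive (+-identityʳ _))))
    extend (suc fuel) {x} {p} {rest} uniq linked path⊆ bound
      with Any? (λ y → T? (adj x y) ×-dec ¬? (y ≟ⱽ p)) xs
    ... | no none = x , path⊆ (here refl) , λ y∈ z∈ x~y x~z → trans (is-p y∈ x~y) (sym (is-p z∈ x~z))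
      where
      is-p : ∀ {y} → y ∈ xs → Adj H x y → y ≡ p
      is-p {y} y∈ x~y with y ≟ⱽ p
      ... | yes y≡p = y≡p
      ... | no  y≢p = contradiction (lose y∈ (x~y , y≢p)) none
    ... | yes some with find some
    ... | y , y∈xs , x~y , y≢p =
      extend fuel (All.tabulate (λ { z∈ refl → new z∈ }) ∷ uniq) (Adj-sym H x~y ∷ linked)
        (λ { (here refl) → y∈xs ; (there z∈) → path⊆ z∈ })
        (≤-trans bound (≤-reflexive (+-suc _ fuel)))
      where
      new : y ∉ x ∷ p ∷ rest
      new (here y≡x)              = Adj⇒≢ H x~y (sym y≡x)
      new (there (here y≡p))      = y≢p y≡p
      new (there (there y∈rest))  = no-chord uniq linked x~y y∈rest

    -- If `x` has no neighbour in `xs`, it is itself a leaf in the sense of `LeafIn`; otherwise an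
    -- edge at `x` is a path to prolong.
    ∃-leaf : ∀ {x} → x ∈ xs → ∃ λ v → v ∈ xs × LeafIn xs v
    ∃-leaf {x} x∈ with Any? (λ y → T? (adj x y)) xs
    ... | no none = x , x∈ , λ y∈ _ x~y _ → contradiction (lose y∈ x~y) none
    ... | yes some with find some
    ... | y , y∈ , x~y = extend (length xs)
      ((≢-sym (Adj⇒≢ H x~y) ∷ []) ∷ [] ∷ []) (Adj-sym H x~y ∷ [-])
      (λ { (here refl) → y∈ ; (there (here refl)) → x∈ }) (s≤s (n≤1+n _))

  -- The field `bounded` leaves room above: for the next leaf in the induction, and finally for the
  -- light vertices.
  record ForestRank (xs : List V) : Set where
    field
      rank       : V → ℕ
      bounded    : ∀ {x} → x ∈ xs → rank x ≤ length xs
      adj⇒≢      : ∀ {x y} → x ∈ xs → y ∈ xs → Adj H x y → rank x ≢ rank y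
      one-parent : ∀ {x y z} → x ∈ xs → y ∈ xs → z ∈ xs → Adj H x y → Adj H x z →
                   rank y ≤ rank x → rank z ≤ rank x → y ≡ z

  -- A leaf is ranked above everything that remains after its removal.
  forestRank : ∀ m xs → length xs ≤ m → ForestRank xs
  forestRank m [] _ = record { rank = λ _ → 0 ; bounded = λ () ; adj⇒≢ = λ () ; one-parent = λ () }
  forestRank (suc m) xs@(_ ∷ _) len with ∃-leaf xs (here refl)
  ... | v , v∈ , leaf = record
    { rank = rank′ ; bounded = bounded′ ; adj⇒≢ = adj⇒≢′ ; one-parent = one-parent′ }
    where
    ys : List V
    ys = _∖_ _≟ⱽ_ xs v

    shorter : length ys < length xs
    shorter = length-∖ _≟ⱽ_ v∈

    open ForestRank (forestRank m ys (≤-pred (≤-trans shorter len)))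

    rank′ : V → ℕ
    rank′ x with x ≟ⱽ v
    ... | yes _ = length xs
    ... | no  _ = rank x

    kept : ∀ {x} → x ∈ xs → x ≢ v → x ∈ ys
    kept = ∈-∖⁺ _≟ⱽ_

    below : ∀ {x} → x ∈ xs → x ≢ v → rank x < length xs
    below x∈ x≢v = ≤-trans (s≤s (bounded (kept x∈ x≢v))) shorter

    bounded′ : ∀ {x} → x ∈ xs → rank′ x ≤ length xs
    bounded′ {x} x∈ with x ≟ⱽ v
    ... | yes _   = ≤-refl
    ... | no  x≢v = <⇒≤ (below x∈ x≢v)

    adj⇒≢′ : ∀ {x y} → x ∈ xs → y ∈ xs → Adj H x y → rank′ x ≢ rank′ y
    adj⇒≢′ {x} {y} x∈ y∈ x~y with x ≟ⱽ v | y ≟ⱽ v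
    ... | yes refl | yes refl = λ _ → Adj⇒≢ H x~y refl
    ... | yes _    | no  y≢v  = >⇒≢ (below y∈ y≢v)
    ... | no  x≢v  | yes _    = <⇒≢ (below x∈ x≢v)
    ... | no  x≢v  | no  y≢v  = adj⇒≢ (kept x∈ x≢v) (kept y∈ y≢v) x~y

    one-parent′ : ∀ {x y z} → x ∈ xs → y ∈ xs → z ∈ xs → Adj H x y → Adj H x z →
                  rank′ y ≤ rank′ x → rank′ z ≤ rank′ x → y ≡ z
    one-parent′ {x} {y} {z} x∈ y∈ z∈ x~y x~z y≤x z≤x with x ≟ⱽ v
    -- The new top vertex has at most one neighbour at all; for any other `x`, the vertex `v` ranks
    -- too high to be a parent.
    ... | yes refl = leaf y∈ z∈ x~y x~z
    ... | no  x≢v with y ≟ⱽ v | z ≟ⱽ v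
    ... | yes _    | _       = contradiction y≤x (<⇒≱ (below x∈ x≢v))
    ... | no  _    | yes _   = contradiction z≤x (<⇒≱ (below x∈ x≢v))
    ... | no  y≢v  | no  z≢v = one-parent (kept x∈ x≢v) (kept y∈ y≢v) (kept z∈ z≢v) x~y x~z y≤x z≤x

-- Counting the earlier conflicts of an edge

module _ {A B : Set} (f : A → List B) where

  length-concatMap≤ : ∀ {m} xs → (∀ {x} → x ∈ xs → length (f x) ≤ m) →
                      length (concatMap f xs) ≤ length xs * m
  length-concatMap≤ []       _ = z≤n
  length-concatMap≤ (x ∷ xs) h =
    ≤-trans (≤-reflexive (length-++ (f x)))
            (+-mono-≤ (h (here refl)) (length-concatMap≤ xs (h ∘ there)))

  -- Every entry pays 1, and the exceptional one pays `m` more. By `Unique` it occurs only once, so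
  -- once it is met all later entries are ordinary.
  length-concatMap≤-exceptional :
    ∀ {P : A → Set} {m xs} → Unique xs →
    (∀ {x} → x ∈ xs → length (f x) ≤ 1 ⊎ (P x × length (f x) ≤ suc m)) →
    (∀ {x y} → x ∈ xs → y ∈ xs → P x → P y → x ≡ y) →
    length (concatMap f xs) ≤ length xs + m
  length-concatMap≤-exceptional [] _ _ = z≤n
  length-concatMap≤-exceptional {m = m} {xs = x ∷ xs} (x∉xs ∷ uniq) h one
    rewrite length-++ (f x) {concatMap f xs} with h (here refl)
  ... | inj₁ fx≤1 = +-mono-≤ fx≤1
    (length-concatMap≤-exceptional uniq (h ∘ there) (λ y∈ z∈ → one (there y∈) (there z∈)))
  ... | inj₂ (px , fx≤1+m) = ≤-trans
    (+-mono-≤ fx≤1+m (≤-trans (length-concatMap≤ xs ordinary) (≤-reflexive (*-identityʳ _))))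
    (≤-reflexive (cong suc (+-comm m _)))
    where
    ordinary : ∀ {y} → y ∈ xs → length (f y) ≤ 1
    ordinary y∈ with h (there y∈)
    ... | inj₁ fy≤1     = fy≤1
    ... | inj₂ (py , _) = contradiction (one (here refl) (there y∈) px py) (All.lookup x∉xs y∈)

module _ {n : ℕ} (G : Graph n) where
  open SimpleGraph G using (adj)
  open Edge

  Heavy : Fin n → Set
  Heavy v = 3 ≤ degree G v

  heavy? : ∀ v → Dec (Heavy v)
  heavy? v = 3 ≤? degree G v

  degree≤Δ : ∀ v → degree G v ≤ Δ G
  degree≤Δ v = All.lookup (map⁻ (xs≤max 0 (map (degree G) (allFin n)))) (∈-allFin v)

  nbrs : Fin n → List (Fin n)
  nbrs v = filter (λ u → T? (adj v u)) (allFin n)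

  nbrs∖ : Fin n → Fin n → List (Fin n)
  nbrs∖ v u = _∖_ _≟_ (nbrs v) u

  ∈-nbrs∖⁺ : ∀ {v u x} → Adj G v x → x ≢ u → x ∈ nbrs∖ v u
  ∈-nbrs∖⁺ v~x x≢u = ∈-∖⁺ _≟_ (∈-filter⁺ _ (∈-allFin _) v~x) x≢u

  ∈-nbrs∖⁻ : ∀ {v u x} → x ∈ nbrs∖ v u → Adj G v x × x ≢ u
  ∈-nbrs∖⁻ {v} x∈ with ∈-∖⁻ _≟_ (nbrs v) x∈
  ... | x∈nbrs , x≢u = proj₂ (∈-filter⁻ (λ u → T? (adj v u)) {xs = allFin n} x∈nbrs) , x≢u

  length-nbrs∖ : ∀ {v u} → Adj G v u → length (nbrs∖ v u) < degree G v
  length-nbrs∖ v~u = length-∖ _≟_ {xs = nbrs _} (∈-filter⁺ _ (∈-allFin _) v~u)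

  nbrs∖-unique : ∀ v u → Unique (nbrs∖ v u)
  nbrs∖-unique v u = Unique-filter⁺ _ (Unique-filter⁺ _ (allFin⁺ n))

  -- Ranking of all vertices.

  record VertexRank : Set where
    field
      rank        : Fin n → ℕ
      heavy<light : ∀ {x y} → Heavy x → ¬ Heavy y → rank x < rank y
      adj⇒≢       : ∀ {x y} → Heavy x → Heavy y → Adj G x y → rank x ≢ rank y
      one-parent  : ∀ {x y z} → Heavy x → Adj G x y → Adj G x z →
                    rank y ≤ rank x → rank z ≤ rank x → y ≡ z

  vertexRank : IsForest (induced G Heavy) → VertexRank
  vertexRank forest = record
    { rank = rank′ ; heavy<light = heavy<light′ ; adj⇒≢ = adj⇒≢′ ; one-parent = one-parent′ }
    where
    ≟-heavy : DecidableEquality (∃ Heavy)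
    -- Proofs of heaviness are all equal, so only the underlying vertices are compared.
    ≟-heavy = ×-≡-dec _≟_ (λ p q → yes (≤-irrelevant p q))

    ifHeavy : Fin n → List (∃ Heavy)
    ifHeavy v with heavy? v
    ... | yes h = [ v , h ]
    ... | no  _ = []

    heavies : List (∃ Heavy)
    heavies = concatMap ifHeavy (allFin n)

    ∈-ifHeavy : ∀ {v} (h : Heavy v) → (v , h) ∈ ifHeavy v
    ∈-ifHeavy {v} h with heavy? v
    ... | yes h′ = here (cong (v ,_) (≤-irrelevant h h′))
    ... | no ¬h  = contradiction h ¬h

    ∈-heavies : ∀ {v} (h : Heavy v) → (v , h) ∈ heavies
    ∈-heavies {v} h = ∈-concatMap⁺ ifHeavy (lose (∈-allFin v) (∈-ifHeavy h))

    open ForestRank (forestRank ≟-heavy (induced G Heavy) forest (length heavies) heavies ≤-refl)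

    rank′ : Fin n → ℕ
    rank′ v with heavy? v
    ... | yes h = rank (v , h)
    -- One more than the bound on heavy ranks. A light vertex is thus never the parent of a heavy
    -- one, while light vertices tie with each other.
    ... | no  _ = suc (length heavies)

    heavy<light′ : ∀ {x y} → Heavy x → ¬ Heavy y → rank′ x < rank′ y
    heavy<light′ {x} {y} hx ¬hy with heavy? x | heavy? y
    ... | yes h | no _  = s≤s (bounded (∈-heavies h))
    ... | no ¬h | _     = contradiction hx ¬h
    ... | yes _ | yes h = contradiction h ¬hy

    adj⇒≢′ : ∀ {x y} → Heavy x → Heavy y → Adj G x y → rank′ x ≢ rank′ y
    adj⇒≢′ {x} {y} hx hy x~y with heavy? x | heavy? y
    ... | yes h | yes h′ = adj⇒≢ (∈-heavies h) (∈-heavies h′) x~y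
    ... | no ¬h | _      = contradiction hx ¬h
    ... | _     | no ¬h  = contradiction hy ¬h

    one-parent′ : ∀ {x y z} → Heavy x → Adj G x y → Adj G x z →
                  rank′ y ≤ rank′ x → rank′ z ≤ rank′ x → y ≡ z
    one-parent′ {x} {y} {z} hx x~y x~z y≤x z≤x with heavy? x | heavy? y | heavy? z
    ... | no ¬h | _     | _      = contradiction hx ¬h
    ... | yes h | no _  | _      = contradiction (bounded (∈-heavies h)) (<⇒≱ y≤x)
    ... | yes h | yes _ | no _   = contradiction (bounded (∈-heavies h)) (<⇒≱ z≤x)
    ... | yes h | yes i | yes j  =
      cong proj₁ (one-parent (∈-heavies h) (∈-heavies i) (∈-heavies j) x~y x~z y≤x z≤x)

  -- Edges are stored with increasing ends; reading them in both directions lets the two ends be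
  -- treated alike.
  data Joins (e : Edge G) : Fin n → Fin n → Set where
    forward  : Joins e (src e) (dst e)
    backward : Joins e (dst e) (src e)

  joins-adj : ∀ {e x y} → Joins e x y → Adj G x y
  joins-adj {e} forward  = adjacent e
  joins-adj {e} backward = Adj-sym G (adjacent e)

  joins-swap : ∀ {e x y} → Joins e x y → Joins e y x
  joins-swap forward  = backward
  joins-swap backward = forward

  joins-unique : ∀ {e f x y} → Joins e x y → Joins f x y → e ≡ f
  joins-unique {edge _ _ _ _} {edge _ _ _ _} forward  forward  = edge-≡ G refl refl
  joins-unique {edge _ _ _ _} {edge _ _ _ _} backward backward = edge-≡ G refl refl
  joins-unique {edge _ _ p _} {edge _ _ q _} forward  backward = contradiction q (<-asym p)
  joins-unique {edge _ _ p _} {edge _ _ q _} backward forward  = contradiction q (<-asym p)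

  endpoint-joins : ∀ {e x} → _endpointOf_ G x e → ∃ λ y → Joins e x y
  endpoint-joins (inj₁ refl) = _ , forward
  endpoint-joins (inj₂ refl) = _ , backward

  between : Fin n → Fin n → List (Edge G)
  between x y with T? (adj x y) | <-cmp x y
  ... | yes x~y | tri< x<y _ _ = [ edge x y x<y x~y ]
  ... | yes x~y | tri> _ _ y<x = [ edge y x y<x (Adj-sym G x~y) ]
  ... | _       | _            = []

  length-between : ∀ x y → length (between x y) ≤ 1
  length-between x y with T? (adj x y) | <-cmp x y
  ... | yes _ | tri< _ _ _ = ≤-refl
  ... | yes _ | tri> _ _ _ = ≤-refl
  ... | yes _ | tri≈ _ _ _ = z≤n
  ... | no _  | _          = z≤n

  ∈-between : ∀ {e x y} → Joins e x y → e ∈ between x y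
  ∈-between {e} {x} {y} j with T? (adj x y) | <-cmp x y
  ... | yes _   | tri< _ _ _   = here (joins-unique j forward)
  ... | yes _   | tri> _ _ _   = here (joins-unique j backward)
  ... | yes x~y | tri≈ _ x≡y _ = contradiction x≡y (Adj⇒≢ G x~y)
  ... | no ¬x~y | _            = contradiction (joins-adj j) ¬x~y

  Close : Rel (Edge G) 0ℓ
  Close e f = ShareEndpoint G e f ⊎ JoinedByEdge G e f

  Close-sym : Symmetric Close
  Close-sym (inj₁ (v , v∈e , v∈f))           = inj₁ (v , v∈f , v∈e)
  Close-sym (inj₂ (u , v , u∈e , v∈f , u~v)) = inj₂ (v , u , v∈f , u∈e , Adj-sym G u~v)

  -- Edges of bounded rank around a given edge.

  module _ (vRank : VertexRank) {m : ℕ} (Δ≤1+m : Δ G ≤ suc m) where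
    open VertexRank vRank

    edgeRank : Edge G → ℕ
    edgeRank e = rank (src e) ⊓ rank (dst e)

    joins-rank : ∀ {e x y} → Joins e x y → edgeRank e ≡ rank x ⊓ rank y
    joins-rank forward      = refl
    joins-rank {e} backward = ⊓-comm (rank (src e)) _

    length-nbrs∖≤ : ∀ {v u} → Adj G v u → length (nbrs∖ v u) ≤ m
    length-nbrs∖≤ {v} v~u = ≤-pred (≤-trans (length-nbrs∖ v~u) (≤-trans (degree≤Δ v) Δ≤1+m))

    length-nbrs∖-light : ∀ {v u} → ¬ Heavy v → Adj G v u → length (nbrs∖ v u) ≤ 1
    length-nbrs∖-light ¬h v~u = ≤-pred (≤-pred (≤-trans (s≤s (length-nbrs∖ v~u)) (≰⇒> ¬h)))

    -- The minimum is the rank of the edge `xy`. The vertex `p` is left out since the edge `xp` is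
    -- either the one being coloured or counted in another star.
    early : Fin n → Fin n → ℕ → List (Fin n)
    early x p t = filter (λ y → rank x ⊓ rank y ≤? t) (nbrs∖ x p)

    star : Fin n → Fin n → ℕ → List (Edge G)
    star x p t = concatMap (between x) (early x p t)

    ∈-star : ∀ {f x y p t} → Joins f x y → y ≢ p → edgeRank f ≤ t → f ∈ star x p t
    ∈-star {t = t} j y≢p f≤t = ∈-concatMap⁺ _ (lose
      (∈-filter⁺ _ (∈-nbrs∖⁺ (joins-adj j) y≢p) (subst (_≤ t) (joins-rank j) f≤t))
      (∈-between j))

    length-star : ∀ x p t → length (star x p t) ≤ length (nbrs∖ x p)
    length-star x p t = ≤-trans
      (length-concatMap≤ (between x) (early x p t) (λ {y} _ → length-between x y))
      (≤-trans (≤-reflexive (*-identityʳ _)) (length-filter _ (nbrs∖ x p)))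

    length-star≤ : ∀ {x p} t → Adj G x p → length (star x p t) ≤ m
    length-star≤ t x~p = ≤-trans (length-star _ _ t) (length-nbrs∖≤ x~p)

    -- Here `p` is the parent of `x`. As `x` ranks above `t`, another edge `xy` of rank at most `t`
    -- would make `y` a second parent.
    star-empty : ∀ {x p t} → Heavy x → Adj G x p → rank p ≤ rank x → t < rank x → star x p t ≡ []
    star-empty {x} {p} {t} hx x~p p≤x t<x =
      cong (concatMap (between x)) (filter-none _ (All.tabulate late))
      where
      late : ∀ {y} → y ∈ nbrs∖ x p → ¬ rank x ⊓ rank y ≤ t
      late {y} y∈ xy≤t with ∈-nbrs∖⁻ y∈ | ⊓-sel (rank x) (rank y)
      ... | _         | inj₁ eq = <⇒≱ t<x (subst (_≤ t) eq xy≤t)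
      ... | x~y , y≢p | inj₂ eq = y≢p (one-parent hx x~y x~p
        (<⇒≤ (≤-trans (s≤s (subst (_≤ t) eq xy≤t)) t<x)) p≤x)

    -- For an edge vu: the edges of rank at most t that meet or neighbour it through v.
    half : Fin n → Fin n → ℕ → List (Edge G)
    half v u t = star v u t ++ concatMap (λ x → star x v t) (nbrs∖ v u)

    length-half : ∀ v u t {a b} → length (star v u t) ≤ a →
                  length (concatMap (λ x → star x v t) (nbrs∖ v u)) ≤ b → length (half v u t) ≤ a + b
    length-half v u t p q = ≤-trans (≤-reflexive (length-++ (star v u t))) (+-mono-≤ p q)

    -- Besides `u` there is at most one neighbour of `v`, with at most `m` further edges. The bound
    -- `a` on the edges at `v` itself is 1 or `m`, depending on the use.
    length-half-light : ∀ {v u a} t → ¬ Heavy v → Adj G v u → length (nbrs∖ v u) ≤ a →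
                        length (half v u t) ≤ a + m
    length-half-light {v} {u} t ¬h v~u ≤a = length-half v u t (≤-trans (length-star v u t) ≤a)
      (≤-trans (length-concatMap≤ (λ x → star x v t) (nbrs∖ v u)
                 (λ x∈ → length-star≤ t (Adj-sym G (proj₁ (∈-nbrs∖⁻ x∈)))))
        (≤-trans (*-monoˡ-≤ m (length-nbrs∖-light ¬h v~u)) (≤-reflexive (*-identityˡ m))))

    -- If `v` is heavy, its parent is `u`, so its own star is empty. Every other neighbour ranks
    -- above `v`: a heavy one has `v` as parent and an empty star, a light one has at most one
    -- further edge.
    length-half-later : ∀ {v u t} → Adj G v u → rank u ≤ t → t < rank v → length (half v u t) ≤ suc m
    length-half-later {v} {u} {t} v~u u≤t t<v with heavy? v
    ... | no ¬h = length-half-light t ¬h v~u (length-nbrs∖-light ¬h v~u)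
    ... | yes h = ≤-trans
      (length-half v u t (≤-reflexive (cong length (star-empty h v~u u≤v t<v)))
        (length-concatMap≤ (λ x → star x v t) (nbrs∖ v u) star≤1))
      (≤-trans (≤-reflexive (*-identityʳ _)) (m≤n⇒m≤1+n (length-nbrs∖≤ v~u)))
      where
      u≤v : rank u ≤ rank v
      u≤v = <⇒≤ (≤-trans (s≤s u≤t) t<v)

      star≤1 : ∀ {x} → x ∈ nbrs∖ v u → length (star x v t) ≤ 1
      star≤1 {x} x∈ with ∈-nbrs∖⁻ x∈ | heavy? x | rank x ≤? rank v
      ... | v~x , _   | no ¬hx | _       =
        ≤-trans (length-star x v t) (length-nbrs∖-light ¬hx (Adj-sym G v~x))
      ... | v~x , x≢u | yes _  | yes x≤v = contradiction (one-parent h v~x v~u x≤v u≤v) x≢u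
      ... | v~x , _   | yes hx | no  x≰v =
        ≤-trans (≤-reflexive (cong length
          (star-empty hx (Adj-sym G v~x) (<⇒≤ (≰⇒> x≰v)) (<-trans t<v (≰⇒> x≰v))))) z≤n

    -- Brings the bound `m` for the star of the parent into the successor form that
    -- `length-concatMap≤-exceptional` asks for.
    heavy⇒m≡1+pred : ∀ {v} → Heavy v → m ≡ suc (pred m)
    heavy⇒m≡1+pred {v} h = sym (suc-pred m ⦃ >-nonZero 0<m ⦄)
      where
      0<m : 0 < m
      0<m = ≤-trans (s≤s z≤n) (≤-pred (≤-trans h (≤-trans (degree≤Δ v) Δ≤1+m)))

    -- The exceptional neighbour is the parent of v.
    length-half-earlier : ∀ {v u} → Heavy v → Adj G v u →
                          length (half v u (rank v)) ≤ m + (m + pred m)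
    -- First the edges at `v`, then one for each further neighbour, and `pred m` extra for the
    -- parent.
    length-half-earlier {v} {u} h v~u = length-half v u (rank v) (length-star≤ (rank v) v~u)
      (≤-trans (length-concatMap≤-exceptional (λ x → star x v (rank v)) (nbrs∖-unique v u) star≤ one)
               (+-monoˡ-≤ (pred m) (length-nbrs∖≤ v~u)))
      where
      star≤ : ∀ {x} → x ∈ nbrs∖ v u →
              length (star x v (rank v)) ≤ 1 ⊎ (rank x ≤ rank v × length (star x v (rank v)) ≤ suc (pred m))
      star≤ {x} x∈ with ∈-nbrs∖⁻ x∈ | heavy? x | rank x ≤? rank v
      ... | v~x , _ | no ¬hx | _       =
        inj₁ (≤-trans (length-star x v (rank v)) (length-nbrs∖-light ¬hx (Adj-sym G v~x)))
      ... | v~x , _ | yes _  | yes x≤v =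
        inj₂ (x≤v , ≤-trans (length-star≤ (rank v) (Adj-sym G v~x)) (≤-reflexive (heavy⇒m≡1+pred h)))
      -- The parent of such an `x` is `v`, and `x` ranks above the threshold.
      ... | v~x , _ | yes hx | no  x≰v =
        inj₁ (≤-trans (≤-reflexive (cong length
          (star-empty hx (Adj-sym G v~x) (<⇒≤ (≰⇒> x≰v)) (≰⇒> x≰v)))) z≤n)

      one : ∀ {x y} → x ∈ nbrs∖ v u → y ∈ nbrs∖ v u → rank x ≤ rank v → rank y ≤ rank v → x ≡ y
      one x∈ y∈ = one-parent h (proj₁ (∈-nbrs∖⁻ x∈)) (proj₁ (∈-nbrs∖⁻ y∈))

    -- The edge saved by `pred m` on the side of `v` pays for the `suc m` on the side of `u`.
    length-halves-heavy : ∀ {v u} → Heavy v → Adj G v u → rank v < rank u →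
                          length (half v u (rank v)) + length (half u v (rank v)) ≤ 4 * m
    length-halves-heavy {v} {u} h v~u v<u = begin
      length (half v u (rank v)) + length (half u v (rank v))
        ≤⟨ +-mono-≤ (length-half-earlier h v~u) (length-half-later (Adj-sym G v~u) ≤-refl v<u) ⟩
      m + (m + pred m) + suc m
        ≡⟨ solve 2 (λ a b → a :+ (a :+ b) :+ (con 1 :+ a) := a :+ (a :+ (a :+ ((con 1 :+ b) :+ con 0)))) refl m (pred m) ⟩
      m + (m + (m + (suc (pred m) + 0)))
        ≡⟨ cong (λ k → m + (m + (m + (k + 0)))) (heavy⇒m≡1+pred h) ⟨
      4 * m ∎
      where
      open ≤-Reasoning
      open +-*-Solver

    length-halves : ∀ {v u} → Adj G v u →
                    length (half v u (rank v ⊓ rank u)) + length (half u v (rank v ⊓ rank u)) ≤ 4 * m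
    length-halves {v} {u} v~u = by-cases (heavy? v) (heavy? u)
      where
      u~v : Adj G u v
      u~v = Adj-sym G v~u

      Goal : ℕ → Set
      Goal t = length (half v u t) + length (half u v t) ≤ 4 * m

      v-first : Heavy v → rank v < rank u → Goal (rank v ⊓ rank u)
      v-first h v<u = subst Goal (sym (m≤n⇒m⊓n≡m (<⇒≤ v<u))) (length-halves-heavy h v~u v<u)

      u-first : Heavy u → rank u < rank v → Goal (rank v ⊓ rank u)
      u-first h u<v = subst Goal (sym (m≥n⇒m⊓n≡n (<⇒≤ u<v)))
        (≤-trans (≤-reflexive (+-comm (length (half v u (rank u))) _)) (length-halves-heavy h u~v u<v))

      by-cases : Dec (Heavy v) → Dec (Heavy u) → Goal (rank v ⊓ rank u)
      by-cases (yes hv) (no ¬hu) = v-first hv (heavy<light hv ¬hu)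
      by-cases (no ¬hv) (yes hu) = u-first hu (heavy<light hu ¬hv)
      by-cases (yes hv) (yes hu) with ℕ-<-cmp (rank v) (rank u)
      ... | tri< v<u _ _ = v-first hv v<u
      ... | tri≈ _ v≡u _ = contradiction v≡u (adj⇒≢ hv hu v~u)
      ... | tri> _ _ u<v = u-first hu u<v
      -- The ranks tell nothing here; degrees alone give `m + m` on each side.
      by-cases (no ¬hv) (no ¬hu) = ≤-trans
        (+-mono-≤ (length-half-light _ ¬hv v~u (length-nbrs∖≤ v~u))
                  (length-half-light _ ¬hu u~v (length-nbrs∖≤ u~v)))
        (≤-reflexive (solve 1 (λ a → a :+ a :+ (a :+ a) := a :+ (a :+ (a :+ (a :+ con 0)))) refl m))
        where open +-*-Solver

    -- Repetitions may occur, for instance an edge of a triangle seen from both sides; they only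
    -- make the count generous.
    earlierClose : Edge G → List (Edge G)
    earlierClose e = half (src e) (dst e) (edgeRank e) ++ half (dst e) (src e) (edgeRank e)

    length-earlierClose : ∀ e → length (earlierClose e) ≤ 4 * m
    length-earlierClose e = ≤-trans
      (≤-reflexive (length-++ (half (src e) (dst e) (edgeRank e)))) (length-halves (adjacent e))

    ∈-star⇒∈-half : ∀ {f x v u t} → Adj G v x → x ≢ u → f ∈ star x v t → f ∈ half v u t
    ∈-star⇒∈-half {v = v} {u} {t} v~x x≢u f∈ =
      ∈-++⁺ʳ (star v u t) (∈-concatMap⁺ _ (lose (∈-nbrs∖⁺ v~x x≢u) f∈))

    -- The ends of `f` decide its star: at `v`, at `u`, or at the further neighbour `b` of `v`. In
    -- the first two cases `f ≢ e` ensures that `f` is not the edge left out.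
    ∈-halves : ∀ {e f v u b y t} → f ≢ e → Joins e v u → Joins f b y → v ≡ b ⊎ Adj G v b →
               edgeRank f ≤ t → f ∈ half v u t ⊎ f ∈ half u v t
    ∈-halves f≢e je jf (inj₁ refl) f≤t =
      inj₁ (∈-++⁺ˡ (∈-star jf (λ { refl → f≢e (joins-unique jf je) }) f≤t))
    ∈-halves {v = v} {u} {b} {y} f≢e je jf (inj₂ v~b) f≤t with b ≟ u | y ≟ v
    ... | yes refl | _        =
      inj₂ (∈-++⁺ˡ (∈-star jf (λ { refl → f≢e (joins-unique jf (joins-swap je)) }) f≤t))
    ... | no b≢u   | yes refl = inj₁ (∈-++⁺ˡ (∈-star (joins-swap jf) b≢u f≤t))
    ... | no b≢u   | no y≢v   = inj₁ (∈-star⇒∈-half v~b b≢u (∈-star jf y≢v f≤t))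

    ∈-earlierClose : ∀ {e f} → f ≢ e → Close e f → edgeRank f ≤ edgeRank e → f ∈ earlierClose e
    ∈-earlierClose {e} {f} f≢e close f≤e = from-close close
      where
      from-joins : ∀ {v u b y} → Joins e v u → Joins f b y → v ≡ b ⊎ Adj G v b → f ∈ earlierClose e
      -- When `e` is read backwards, the two halves change places.
      from-joins je jf v≃b with je | ∈-halves f≢e je jf v≃b f≤e
      ... | forward  | inj₁ f∈ = ∈-++⁺ˡ f∈
      ... | forward  | inj₂ f∈ = ∈-++⁺ʳ (half (src e) (dst e) (edgeRank e)) f∈
      ... | backward | inj₁ f∈ = ∈-++⁺ʳ (half (src e) (dst e) (edgeRank e)) f∈
      ... | backward | inj₂ f∈ = ∈-++⁺ˡ f∈

      from-close : Close e f → f ∈ earlierClose e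
      from-close (inj₁ (_ , v∈e , v∈f)) =
        from-joins (proj₂ (endpoint-joins v∈e)) (proj₂ (endpoint-joins v∈f)) (inj₁ refl)
      from-close (inj₂ (_ , _ , u∈e , v∈f , u~v)) =
        from-joins (proj₂ (endpoint-joins u∈e)) (proj₂ (endpoint-joins v∈f)) (inj₂ u~v)

    stronglyEdgeColorable : StronglyEdgeColorable G (suc (4 * m))
    stronglyEdgeColorable =
      greedy (_≟ᴱ_ G) edgeRank Close (λ {e} {f} → Close-sym {e} {f}) earlierClose length-earlierClose ∈-earlierClose
        (edges G) (∈-edges G)

  -- The bound for graphs with an edge.

  edge⇒0<Δ : Edge G → 0 < Δ G
  edge⇒0<Δ e = ≤-trans (s≤s z≤n) (≤-trans (length-nbrs∖ {v = src e} (adjacent e)) (degree≤Δ (src e)))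

theorem4 : ∀ (n : ℕ) (G : Graph n) → Edge G → IsForest (induced G (λ v → 3 ≤ degree G v)) → χ′ₛ G ≤ 4 * Δ G ∸ 3
theorem4 n G e forest = proj₂ (χ′ₛ-isMinimum G) (4 * Δ G ∸ 3)
  (subst (StronglyEdgeColorable G) colours (stronglyEdgeColorable G (vertexRank G forest) (≤-reflexive Δ≡1+m)))
  where
  m : ℕ
  m = pred (Δ G)

  Δ≡1+m : Δ G ≡ suc m
  Δ≡1+m = sym (suc-pred (Δ G) ⦃ >-nonZero (edge⇒0<Δ G e) ⦄)

  -- Because the edge makes `Δ G` positive, the truncated subtraction is exact.
  colours : suc (4 * m) ≡ 4 * Δ G ∸ 3
  colours = sym (trans (cong (λ k → 4 * k ∸ 3) Δ≡1+m) (cong (_∸ 3) (*-suc 4 m)))
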